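{- For every positive integer $n$, every triangle-free graph on $n$ vertices contains at most $\left(\frac{n}{5}\right)^5$ cycles of length 5.
   Context: Graphs are finite and simple. A cycle of length 5 is a subgraph isomorphic to $C_5$, counted as an unlabelled subgraph. -}

module Defs where

import Algebra.Definitions.RawSemiring
open import Data.Fin.Base using (Fin; toℕ)
open import Data.Fin.Properties using (all?)
open import Data.Fin.Subset using (Subset; _∈_)
open import Data.Nat.Base using (ℕ; suc; _%_)
import Data.Nat.Properties as ℕ
open import Data.Product.Base using (_×_; _,_; ∃; proj₁)
open import Data.Rational.Base using (+-*-rawSemiring)
open import Data.Sum.Base using (_⊎_; [_,_]; swap)
open import Function.Bundles using (_↔_; _⇔_; Inverse)
open import Function.Construct.Composition using (_⇔-∘_)
open import Function.Construct.Identity using (⇔-id)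
open import Function.Construct.Symmetry using (⇔-sym)
open import Level using (0ℓ)
import Level
open import Relation.Binary.Bundles using (Setoid)
open import Relation.Binary.Core using (Rel)
open import Relation.Binary.Definitions using (Decidable; Symmetric)
open import Relation.Binary.PropositionalEquality using (_≡_; refl; sym; trans)
open import Relation.Nullary.Decidable using (_⊎-dec_; ¬?; from-yes)
open import Relation.Nullary.Negation using (¬_)

open Algebra.Definitions.RawSemiring +-*-rawSemiring public using (_^_)

record Graph (V : Set) : Set₁ where
  field
    _~_      : Rel V 0ℓ
    ~-sym    : Symmetric _~_
    ~-irrefl : ∀ v → ¬ (v ~ v)
    _~?_     : Decidable _~_

TriangleFree : {V : Set} → Graph V → Set
TriangleFree G = ∀ x y z → ¬ (x ~ y × y ~ z × z ~ x)
  where open Graph G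

record _≅_ {V W : Set} (G : Graph V) (H : Graph W) : Set where
  private
    module G = Graph G
    module H = Graph H
  field
    bijection : V ↔ W
  open Inverse bijection public using (to; from)
  field
    preserves : ∀ x y → (x G.~ y) ⇔ (to x H.~ to y)

C₅ : Graph (Fin 5)
C₅ = record
  { _~_      = λ i j → Next i j ⊎ Next j i
  ; ~-sym    = swap
  ; ~-irrefl = λ i → [ irrefl i , irrefl i ]
  ; _~?_     = λ i j → next? i j ⊎-dec next? j i
  }
  where
  Next : Rel (Fin 5) 0ℓ
  Next i j = toℕ j ≡ suc (toℕ i) % 5

  next? : Decidable Next
  next? i j = toℕ j ℕ.≟ suc (toℕ i) % 5

  irrefl : ∀ i → ¬ Next i i
  irrefl = from-yes (all? λ i → ¬? (next? i i))

-- Not necessarily induced: both the vertex set and the edge set are chosen.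
record Subgraph {n : ℕ} (G : Graph (Fin n)) : Set₁ where
  open Graph G
  field
    vertices : Subset n
    Edge     : Rel (Fin n) 0ℓ
    edge-sym : Symmetric Edge
    edge?    : Decidable Edge
    edge⇒~   : ∀ {u v} → Edge u v → u ~ v
    edge⇒∈   : ∀ {u v} → Edge u v → u ∈ vertices × v ∈ vertices

  graph : Graph (∃ λ v → v ∈ vertices)
  graph = record
    { _~_      = λ x y → Edge (proj₁ x) (proj₁ y)
    ; ~-sym    = edge-sym
    ; ~-irrefl = λ x e → ~-irrefl (proj₁ x) (edge⇒~ e)
    ; _~?_     = λ x y → edge? (proj₁ x) (proj₁ y)
    }

-- Two subgraphs are the same when they have the same vertices and the same
-- edges; the proofs that edges exist are not compared.
subgraphs : {n : ℕ} → Graph (Fin n) → Setoid (Level.suc 0ℓ) 0ℓ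
subgraphs G = record
  { Carrier       = Subgraph G
  ; _≈_           = λ H K → vertices H ≡ vertices K
                          × (∀ u v → Edge H u v ⇔ Edge K u v)
  ; isEquivalence = record
    { refl  = refl , λ u v → ⇔-id _
    ; sym   = λ (p , f) → sym p , λ u v → ⇔-sym (f u v)
    ; trans = λ (p , f) (q , g) → trans p q , λ u v → g u v ⇔-∘ f u v
    }
  }
  where open Subgraph

IsFiveCycle : {n : ℕ} {G : Graph (Fin n)} → Subgraph G → Set
IsFiveCycle H = Subgraph.graph H ≅ C₅

-- Flag algebras.  A closed walk of length 5 in a triangle-free graph is a
-- 5-cycle, so a graph with c pentagons has at least 10 c such closed walks, and
-- it suffices to show that at most 2/625 of all 5-tuples of vertices are closed
-- walks.  Fix three vertices a, b, c; a linear form ℓ in the adjacency of a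
-- fourth vertex x to them satisfies Σ_x Σ_y ℓ(x) ℓ(y) = (Σ_x ℓ(x))² ≥ 0.
-- Suitable weighted sums of such squares, added to 10000 times the indicator of
-- closed walks, have an average of at most 32 over the 120 orderings of any five
-- vertices; as this average depends only on the adjacencies among the five
-- vertices, it is checked by evaluating all triangle-free patterns.

module Submission where

open import Defs
open import Data.Fin.Base using (Fin)
open import Data.Integer.Base using (+_)
open import Data.List.Base using (List; length)
open import Data.List.Relation.Unary.All using (All)
open import Data.List.Relation.Unary.Unique.Setoid using (Unique)
open import Data.Nat.Base using (ℕ; NonZero)
open import Data.Rational.Base using (_/_; _≤_)

import Algebra.Definitions.RawSemiring
import Algebra.Properties.Semiring.Sum
open import Data.Bool.Base using (Bool; true; false; _∧_; not; T)
open import Data.Bool.Properties using (T?; T-∧; T-≡)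
open import Data.Fin.Base using (zero; suc)
open import Data.Fin.Patterns
import Data.Fin.Properties as Fin
open import Data.Fin.Subset using (_∈_)
open import Data.Fin.Subset.Properties using (⊆-antisym)
open import Data.Integer.Base using (ℤ; -[1+_]; -_; 0ℤ; 1ℤ; +≤+; _+_; _*_)
import Data.Integer.Base as ℤ
import Data.Integer.Properties as ℤ
open import Data.List.Base using ([]; _∷_; _++_; foldr; map; filter; inits; cartesianProductWith)
open import Data.List.Membership.Propositional using () renaming (_∈_ to _∈ₗ_)
open import Data.List.Membership.Propositional.Properties using (∈-map⁻; ∈-++⁻)
open import Data.List.Properties using (length-++; foldr-cong)
open import Data.List.Relation.Unary.All using ([]; _∷_)
import Data.List.Relation.Unary.All as All
import Data.List.Relation.Unary.All.Properties as All
open import Data.List.Relation.Unary.AllPairs using ([]; _∷_)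
open import Data.List.Relation.Unary.Any using (Any; here; there)
import Data.List.Relation.Unary.Unique.DecPropositional as DecUnique
open import Data.List.Relation.Unary.Unique.Propositional using () renaming (Unique to Uniqueₚ)
open import Data.List.Relation.Unary.Unique.Propositional.Properties using (map⁺; ++⁺)
open import Data.Nat.Base using (zero; suc; z≤n)
import Data.Nat.Base as ℕ
open import Data.Product.Base using (_×_; _,_; proj₁; proj₂; ∃; -,_)
open import Data.Rational.Base using (toℚᵘ)
import Data.Rational.Properties as ℚ
import Data.Rational.Unnormalised.Base as ℚᵘ
import Data.Rational.Unnormalised.Properties as ℚᵘ
open import Data.Sum.Base using (inj₁; inj₂)
open import Data.Unit.Base using (⊤; tt)
open import Data.Vec.Base using (Vec; []; _∷_; lookup; allFin)
import Data.Vec.Base as Vec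
import Data.Vec.Properties as Vec
open import Data.Vec.Properties.WithK using ([]=-irrelevant)
open import Function.Base using (_∘_)
open import Function.Bundles using (_⇔_; mk⇔; module Equivalence; module Inverse)
open import Relation.Binary.PropositionalEquality
  using (_≡_; _≗_; refl; sym; trans; cong; cong₂; subst; subst₂; module ≡-Reasoning)
open import Relation.Nullary.Decidable
  using (Dec; yes; no; does; map′; _×-dec_; _→-dec_; ¬?; from-yes; toWitness; fromWitness;
         dec-true; dec-false; ⌊_⌋)
open import Relation.Nullary.Negation using (¬_; contradiction)

open Algebra.Definitions.RawSemiring ℚᵘ.+-*-rawSemiring using () renaming (_^_ to _^ᵘ_)
open Algebra.Properties.Semiring.Sum ℤ.+-*-semiring
  using (sum; sum-cong-≗; ∑-comm; ∑-distrib-+; *-distribˡ-sum; *-distribʳ-sum)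
open Equivalence using (to; from)

-- Sums over vertices and over tuples of vertices.

sum-mono-≤ : ∀ {n} {f g : Fin n → ℤ} → (∀ i → f i ℤ.≤ g i) → sum f ℤ.≤ sum g
sum-mono-≤ {zero}  f≤g = ℤ.≤-refl
sum-mono-≤ {suc n} f≤g = ℤ.+-mono-≤ (f≤g zero) (sum-mono-≤ (f≤g ∘ suc))

sum-nonneg : ∀ {n} {f : Fin n → ℤ} → (∀ i → 0ℤ ℤ.≤ f i) → 0ℤ ℤ.≤ sum f
sum-nonneg {zero}  0≤f = ℤ.≤-refl
sum-nonneg {suc n} 0≤f = ℤ.+-mono-≤ (0≤f zero) (sum-nonneg (0≤f ∘ suc))

sum-const : ∀ n c → sum {n} (λ _ → c) ≡ + n * c
sum-const zero    c = refl
sum-const (suc n) c = trans (cong (λ s → c + s) (sum-const n c)) (sym (ℤ.suc-* (+ n) c))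

term≤sum : ∀ {n} {f : Fin n → ℤ} → (∀ i → 0ℤ ℤ.≤ f i) → ∀ i → f i ℤ.≤ sum f
term≤sum {suc n} {f} 0≤f zero    = begin
  f zero                  ≡⟨ ℤ.+-identityʳ (f zero) ⟨
  f zero + 0ℤ             ≤⟨ ℤ.+-monoʳ-≤ (f zero) (sum-nonneg (0≤f ∘ suc)) ⟩
  f zero + sum (f ∘ suc)  ∎
  where open ℤ.≤-Reasoning
term≤sum {suc n} {f} 0≤f (suc i) = begin
  f (suc i)               ≡⟨ ℤ.+-identityˡ (f (suc i)) ⟨
  0ℤ + f (suc i)          ≤⟨ ℤ.+-mono-≤ (0≤f zero) (term≤sum (0≤f ∘ suc) i) ⟩
  f zero + sum (f ∘ suc)  ∎
  where open ℤ.≤-Reasoning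

∑ⱽ : ∀ {n k} → (Vec (Fin n) k → ℤ) → ℤ
∑ⱽ {k = zero}  f = f []
∑ⱽ {k = suc k} f = sum λ x → ∑ⱽ λ v → f (x ∷ v)

module _ {n : ℕ} where

  ∑ⱽ-cong : ∀ {k} {f g : Vec (Fin n) k → ℤ} → f ≗ g → ∑ⱽ f ≡ ∑ⱽ g
  ∑ⱽ-cong {zero}  f≗g = f≗g []
  ∑ⱽ-cong {suc k} f≗g = sum-cong-≗ λ x → ∑ⱽ-cong λ v → f≗g (x ∷ v)

  ∑ⱽ-mono-≤ : ∀ {k} {f g : Vec (Fin n) k → ℤ} → (∀ v → f v ℤ.≤ g v) → ∑ⱽ f ℤ.≤ ∑ⱽ g
  ∑ⱽ-mono-≤ {zero}  f≤g = f≤g []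
  ∑ⱽ-mono-≤ {suc k} f≤g = sum-mono-≤ λ x → ∑ⱽ-mono-≤ λ v → f≤g (x ∷ v)

  ∑ⱽ-nonneg : ∀ {k} {f : Vec (Fin n) k → ℤ} → (∀ v → 0ℤ ℤ.≤ f v) → 0ℤ ℤ.≤ ∑ⱽ f
  ∑ⱽ-nonneg {zero}  0≤f = 0≤f []
  ∑ⱽ-nonneg {suc k} 0≤f = sum-nonneg λ x → ∑ⱽ-nonneg λ v → 0≤f (x ∷ v)

  ∑ⱽ-const : ∀ k c → ∑ⱽ {n} {k} (λ _ → c) ≡ (+ n) ℤ.^ k * c
  ∑ⱽ-const zero    c = sym (ℤ.*-identityˡ c)
  ∑ⱽ-const (suc k) c = begin
    sum {n} (λ _ → ∑ⱽ {n} {k} (λ _ → c)) ≡⟨ sum-cong-≗ {n} (λ _ → ∑ⱽ-const k c) ⟩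
    sum {n} (λ _ → (+ n) ℤ.^ k * c)      ≡⟨ sum-const n _ ⟩
    + n * ((+ n) ℤ.^ k * c)              ≡⟨ ℤ.*-assoc (+ n) ((+ n) ℤ.^ k) c ⟨
    (+ n) ℤ.^ suc k * c                  ∎
    where open ≡-Reasoning

  ∑ⱽ-+ : ∀ {k} (f g : Vec (Fin n) k → ℤ) → ∑ⱽ (λ v → f v + g v) ≡ ∑ⱽ f + ∑ⱽ g
  ∑ⱽ-+ {zero}  f g = refl
  ∑ⱽ-+ {suc k} f g = trans
    (sum-cong-≗ λ x → ∑ⱽ-+ (λ v → f (x ∷ v)) (λ v → g (x ∷ v)))
    (∑-distrib-+ (λ x → ∑ⱽ λ v → f (x ∷ v)) (λ x → ∑ⱽ λ v → g (x ∷ v)))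

  ∑ⱽ-*ˡ : ∀ {k} c (f : Vec (Fin n) k → ℤ) → ∑ⱽ (λ v → c * f v) ≡ c * ∑ⱽ f
  ∑ⱽ-*ˡ {zero}  c f = refl
  ∑ⱽ-*ˡ {suc k} c f = trans
    (sum-cong-≗ λ x → ∑ⱽ-*ˡ c (λ v → f (x ∷ v)))
    (sym (*-distribˡ-sum c λ x → ∑ⱽ λ v → f (x ∷ v)))

  term≤∑ⱽ : ∀ {k} {f : Vec (Fin n) k → ℤ} → (∀ v → 0ℤ ℤ.≤ f v) → ∀ v → f v ℤ.≤ ∑ⱽ f
  term≤∑ⱽ 0≤f []      = ℤ.≤-refl
  term≤∑ⱽ 0≤f (x ∷ v) = ℤ.≤-trans
    (term≤∑ⱽ (λ v → 0≤f (x ∷ v)) v)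
    (term≤sum (λ x → ∑ⱽ-nonneg λ v → 0≤f (x ∷ v)) x)

-- Permuting the positions of a tuple.

transpose : ∀ {A : Set} {n} → Fin n → Vec A (suc n) → Vec A (suc n)
transpose zero    (x ∷ y ∷ v) = y ∷ x ∷ v
transpose (suc i) (x ∷ v)     = x ∷ transpose i v

transpose-map : ∀ {A B : Set} {n} (g : A → B) (i : Fin n) v →
  transpose i (Vec.map g v) ≡ Vec.map g (transpose i v)
transpose-map g zero    (x ∷ y ∷ v) = refl
transpose-map g (suc i) (x ∷ v)     = cong (g x ∷_) (transpose-map g i v)

-- Swapping neighbouring coordinates interchanges two consecutive summations.
∑ⱽ-transpose : ∀ {n k} (i : Fin k) (f : Vec (Fin n) (suc k) → ℤ) →
  ∑ⱽ (f ∘ transpose i) ≡ ∑ⱽ f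
∑ⱽ-transpose zero    f = ∑-comm λ x y → ∑ⱽ λ v → f (y ∷ x ∷ v)
∑ⱽ-transpose (suc i) f = sum-cong-≗ λ x → ∑ⱽ-transpose i λ v → f (x ∷ v)

-- Permutations are encoded as words in adjacent transpositions, the last letter acting first, so
-- invariance of sums reduces to a single swap.
act : ∀ {A : Set} {n} → List (Fin n) → Vec A (suc n) → Vec A (suc n)
act w v = foldr transpose v w

act-map : ∀ {A B : Set} {n} (g : A → B) (w : List (Fin n)) v →
  act w (Vec.map g v) ≡ Vec.map g (act w v)
act-map g []      v = refl
act-map g (i ∷ w) v =
  trans (cong (transpose i) (act-map g w v)) (transpose-map g i (act w v))

∑ⱽ-act : ∀ {n k} (w : List (Fin k)) (f : Vec (Fin n) (suc k) → ℤ) →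
  ∑ⱽ (f ∘ act w) ≡ ∑ⱽ f
∑ⱽ-act []      f = refl
∑ⱽ-act (i ∷ w) f = trans (∑ⱽ-act w (f ∘ transpose i)) (∑ⱽ-transpose i f)

∑ₗ : {A : Set} → List A → (A → ℤ) → ℤ
∑ₗ xs f = foldr (λ x s → f x + s) 0ℤ xs

∑ₗ-cong : ∀ {A : Set} (xs : List A) {f g : A → ℤ} → f ≗ g → ∑ₗ xs f ≡ ∑ₗ xs g
∑ₗ-cong xs f≗g = foldr-cong (λ x s → cong (_+ s) (f≗g x)) refl xs

-- A sum over the words instead of an average, which keeps the values in `ℤ`; bounds over `S₅` are
-- therefore 120 times those for the average.
symm : ∀ {A : Set} {n} → List (List (Fin n)) → (Vec A (suc n) → ℤ) → Vec A (suc n) → ℤ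
symm ws f v = ∑ₗ ws λ w → f (act w v)

∑ⱽ-symm : ∀ {n k} ws (f : Vec (Fin n) (suc k) → ℤ) →
  ∑ⱽ (symm ws f) ≡ + length ws * ∑ⱽ f
∑ⱽ-symm {n} {k} [] f = trans (∑ⱽ-const {n} (suc k) 0ℤ) (ℤ.*-zeroʳ ((+ n) ℤ.^ suc k))
∑ⱽ-symm (w ∷ ws)   f = begin
  ∑ⱽ (λ v → f (act w v) + symm ws f v) ≡⟨ ∑ⱽ-+ (f ∘ act w) (symm ws f) ⟩
  ∑ⱽ (f ∘ act w) + ∑ⱽ (symm ws f)      ≡⟨ cong₂ _+_ (∑ⱽ-act w f) (∑ⱽ-symm ws f) ⟩
  ∑ⱽ f + + length ws * ∑ⱽ f            ≡⟨ ℤ.suc-* (+ length ws) (∑ⱽ f) ⟨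
  + length (w ∷ ws) * ∑ⱽ f             ∎
  where open ≡-Reasoning

-- Every permutation of five positions is a product of one prefix of each of
-- s₀, s₁s₀, s₂s₁s₀ and s₃s₂s₁s₀.
S₅ : List (List (Fin 4))
S₅ = inits (0F ∷ []) ⊗ inits (1F ∷ 0F ∷ []) ⊗ inits (2F ∷ 1F ∷ 0F ∷ [])
   ⊗ inits (3F ∷ 2F ∷ 1F ∷ 0F ∷ [])
  where
  infixr 5 _⊗_
  _⊗_ = cartesianProductWith _++_

-- Boolean adjacency patterns.

𝟙 : Bool → ℤ
𝟙 true  = 1ℤ
𝟙 false = 0ℤ

𝟙-nonneg : ∀ b → 0ℤ ℤ.≤ 𝟙 b
𝟙-nonneg true  = +≤+ z≤n
𝟙-nonneg false = +≤+ z≤n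

-- The adjacencies of a finite sequence of vertices: those of the first vertex
-- with the later ones, then the pattern of the later ones.  Repeated vertices
-- are allowed and count as non-adjacent.
Pattern : ℕ → Set
Pattern zero    = ⊤
Pattern (suc n) = Vec Bool n × Pattern n

adj : ∀ {n} → Pattern n → Fin n → Fin n → Bool
adj (r , p) zero    zero    = false
adj (r , p) zero    (suc j) = lookup r j
adj (r , p) (suc i) zero    = lookup r i
adj (r , p) (suc i) (suc j) = adj p i j

pattern-of : ∀ {V : Set} {n} → (V → V → Bool) → Vec V n → Pattern n
pattern-of e []      = tt
pattern-of e (x ∷ v) = Vec.map (e x) v , pattern-of e v

-- A pattern stores each pair of positions once and omits the diagonal; symmetry recovers the
-- reversed pairs and irreflexivity the diagonal.
adj-pattern-of : ∀ {V : Set} {n} {e : V → V → Bool} →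
  (∀ x y → e x y ≡ e y x) → (∀ x → e x x ≡ false) →
  (v : Vec V n) → ∀ i j → e (lookup v i) (lookup v j) ≡ adj (pattern-of e v) i j
adj-pattern-of e-sym e-irr (x ∷ v) zero    zero    = e-irr x
adj-pattern-of e-sym e-irr (x ∷ v) zero    (suc j) = sym (Vec.lookup-map j _ v)
adj-pattern-of e-sym e-irr (x ∷ v) (suc i) zero    =
  trans (e-sym (lookup v i) x) (sym (Vec.lookup-map i _ v))
adj-pattern-of e-sym e-irr (x ∷ v) (suc i) (suc j) = adj-pattern-of e-sym e-irr v i j

∀-vec? : ∀ {n} {P : Vec Bool n → Set} → (∀ v → Dec (P v)) → Dec (∀ v → P v)
∀-vec? {zero}  P? = map′ (λ { p [] → p }) (λ f → f []) (P? [])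
∀-vec? {suc n} P? = map′
  (λ { (f , g) (true ∷ v) → f v ; (f , g) (false ∷ v) → g v })
  (λ f → (λ v → f (true ∷ v)) , (λ v → f (false ∷ v)))
  (∀-vec? (λ v → P? (true ∷ v)) ×-dec ∀-vec? (λ v → P? (false ∷ v)))

∀-pattern? : ∀ {n} {P : Pattern n → Set} → (∀ p → Dec (P p)) → Dec (∀ p → P p)
∀-pattern? {zero}  P? = map′ (λ p _ → p) (λ f → f tt) (P? tt)
∀-pattern? {suc n} P? = map′ (λ f (r , p) → f p r) (λ f p r → f (r , p))
  (∀-pattern? λ p → ∀-vec? λ r → P? (r , p))

NoTriangle : {V : Set} → (V → V → Bool) → Set
NoTriangle e = ∀ x y z → ¬ T (e x y ∧ e y z ∧ e z x)

noTriangle? : ∀ {n} (p : Pattern n) → Dec (NoTriangle (adj p))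
noTriangle? p = Fin.all? λ x → Fin.all? λ y → Fin.all? λ z →
  ¬? (T? (adj p x y ∧ adj p y z ∧ adj p z x))

-- Flags and the sum-of-squares certificate.

Flag : Set
Flag = Bool × Bool × Bool

-- The arguments are the values at the flags whose last vertex is adjacent to
-- none, to 1, 2, 3, to 1 2, 1 3, 2 3, and to all three labelled vertices.
⟨_,_,_,_,_,_,_,_⟩ : (o a b c ab ac bc abc : ℤ) → Flag → ℤ
⟨ o , a , b , c , ab , ac , bc , abc ⟩ (false , false , false) = o
⟨ o , a , b , c , ab , ac , bc , abc ⟩ (true  , false , false) = a
⟨ o , a , b , c , ab , ac , bc , abc ⟩ (false , true  , false) = b
⟨ o , a , b , c , ab , ac , bc , abc ⟩ (false , false , true ) = c
⟨ o , a , b , c , ab , ac , bc , abc ⟩ (true  , true  , false) = ab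
⟨ o , a , b , c , ab , ac , bc , abc ⟩ (true  , false , true ) = ac
⟨ o , a , b , c , ab , ac , bc , abc ⟩ (false , true  , true ) = bc
⟨ o , a , b , c , ab , ac , bc , abc ⟩ (true  , true  , true ) = abc

-- A rational solution of the flag algebra semidefinite program, one weighted
-- sum of squares for each of the types "no edge", "edge 12" and "path 123".
-- Every form vanishes on the flag densities of the blow-up of C₅.
squares : Flag → List (ℕ × (Flag → ℤ))
squares (false , false , false) =
    (2   , ⟨ + 4 , - + 9 , - + 9 , - + 9 , + 7 , + 7 , + 7 , - + 6 ⟩)
  ∷ (78  , ⟨ + 0 , + 1 , + 1 , + 1 , - + 1 , - + 1 , - + 1 , + 0 ⟩)
  ∷ []
squares (true , false , false) =
    (312 , ⟨ + 0 , + 1 , - + 1 , + 0 , + 0 , + 4 , - + 4 , + 0 ⟩)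
  ∷ (192 , ⟨ + 0 , + 0 , + 0 , + 0 , + 0 , + 1 , - + 1 , + 0 ⟩)
  ∷ (5   , ⟨ + 12 , - + 7 , - + 7 , - + 14 , + 0 , + 1 , + 1 , + 0 ⟩)
  ∷ (347 , ⟨ + 0 , - + 1 , - + 1 , + 2 , + 0 , + 1 , + 1 , + 0 ⟩)
  ∷ []
squares (true , false , true) =
    (1   , ⟨ + 44 , + 19 , - + 16 , + 19 , + 0 , - + 6 , + 0 , + 0 ⟩)
  ∷ (5   , ⟨ - + 4 , - + 1 , + 0 , - + 1 , + 0 , + 2 , + 0 , + 0 ⟩)
  ∷ (342 , ⟨ + 0 , + 1 , + 0 , - + 1 , + 0 , + 0 , + 0 , + 0 ⟩)
  ∷ []
squares _ = []

quadratic : List (ℕ × (Flag → ℤ)) → Flag → Flag → ℤ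
quadratic qs x y = ∑ₗ qs λ (w , ℓ) → + w * (ℓ x * ℓ y)

module _ {V : Set} (e : V → V → Bool) where

  isPentagon : Vec V 5 → Bool
  isPentagon (a ∷ b ∷ c ∷ x ∷ y ∷ []) = e a b ∧ e b c ∧ e x c ∧ e y x ∧ e y a

  -- The edges among the labelled vertices `a`, `b`, `c` select the type, and `x` and `y` each carry
  -- a flag over it. The adjacency of `x` and `y` does not enter, so the sum over both breaks up
  -- into squares.
  form : Vec V 5 → ℤ
  form (a ∷ b ∷ c ∷ x ∷ y ∷ []) =
    quadratic (squares (e a b , e a c , e b c))
      (e x a , e x b , e x c) (e y a , e y b , e y c)

  certificate : Vec V 5 → ℤ
  certificate v = + 10000 * 𝟙 (isPentagon v) + form v

-- A finite computation: five positions have ten pairs, hence 1024 patterns, and those with a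
-- triangle are dismissed by `noTriangle?`. The bound is 120 times 32.
certificate-pattern : ∀ p → NoTriangle (adj p) →
  symm S₅ (certificate (adj p)) (allFin 5) ℤ.≤ + 3840
certificate-pattern = from-yes (∀-pattern? λ p →
  noTriangle? p →-dec (symm S₅ (certificate (adj p)) (allFin 5) ℤ.≤? + 3840))

-- The certificate sees vertices only through adjacencies, so a value computed on the positions of a
-- pattern carries over to the vertices of a graph.
certificate-map : ∀ {U V : Set} {e : V → V → Bool} {e′ : U → U → Bool} {g : U → V} →
  (∀ x y → e (g x) (g y) ≡ e′ x y) →
  ∀ v → certificate e (Vec.map g v) ≡ certificate e′ v
certificate-map eq (a ∷ b ∷ c ∷ x ∷ y ∷ []) = cong₂ (λ p s → + 10000 * 𝟙 p + s)
  (cong₂ _∧_ (eq a b) (cong₂ _∧_ (eq b c) (cong₂ _∧_ (eq x c) (cong₂ _∧_ (eq y x) (eq y a)))))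
  (cong (λ (τ , φ , ψ) → quadratic (squares τ) φ ψ)
    (cong₂ _,_ (triple (eq a b) (eq a c) (eq b c))
      (cong₂ _,_ (triple (eq x a) (eq x b) (eq x c)) (triple (eq y a) (eq y b) (eq y c)))))
  where
  triple : ∀ {p p′ q q′ r r′ : Bool} → p ≡ p′ → q ≡ q′ → r ≡ r′ →
    (p , q , r) ≡ (p′ , q′ , r′)
  triple p q r = cong₂ _,_ p (cong₂ _,_ q r)

-- Averaging the certificate over all tuples.

quadratic-nonneg : ∀ {n} qs (φ : Fin n → Flag) →
  0ℤ ℤ.≤ sum λ x → sum λ y → quadratic qs (φ x) (φ y)
quadratic-nonneg {n} [] φ = sum-nonneg {n} λ x → sum-nonneg {n} λ y → ℤ.≤-refl
quadratic-nonneg ((w , ℓ) ∷ qs) φ = subst (0ℤ ℤ.≤_) (sym split)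
  (ℤ.+-mono-≤ square (quadratic-nonneg qs φ))
  where
  open ≡-Reasoning
  S = sum (ℓ ∘ φ)

  0≤i*i : ∀ i → 0ℤ ℤ.≤ i * i
  0≤i*i (+ n)    = subst (0ℤ ℤ.≤_) (ℤ.pos-* n n) (+≤+ z≤n)
  0≤i*i -[1+ n ] = +≤+ z≤n

  square : 0ℤ ℤ.≤ + w * (S * S)
  square = subst (ℤ._≤ + w * (S * S)) (ℤ.*-zeroʳ (+ w)) (ℤ.*-monoˡ-≤-nonNeg (+ w) (0≤i*i S))

  factor : sum (λ x → sum λ y → + w * (ℓ (φ x) * ℓ (φ y))) ≡ + w * (S * S)
  factor = begin
    sum (λ x → sum λ y → + w * (ℓ (φ x) * ℓ (φ y)))
      ≡⟨ sum-cong-≗ (λ x → *-distribˡ-sum (+ w) (λ y → ℓ (φ x) * ℓ (φ y))) ⟨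
    sum (λ x → + w * sum λ y → ℓ (φ x) * ℓ (φ y))
      ≡⟨ sum-cong-≗ (λ x → cong (+ w *_) (*-distribˡ-sum (ℓ (φ x)) (ℓ ∘ φ))) ⟨
    sum (λ x → + w * (ℓ (φ x) * S))
      ≡⟨ *-distribˡ-sum (+ w) (λ x → ℓ (φ x) * S) ⟨
    + w * sum (λ x → ℓ (φ x) * S)
      ≡⟨ cong (+ w *_) (*-distribʳ-sum S (ℓ ∘ φ)) ⟨
    + w * (S * S) ∎

  split : sum (λ x → sum λ y → + w * (ℓ (φ x) * ℓ (φ y)) + quadratic qs (φ x) (φ y))
        ≡ + w * (S * S) + sum λ x → sum λ y → quadratic qs (φ x) (φ y)
  split = begin
    _ ≡⟨ sum-cong-≗ (λ x → ∑-distrib-+ (λ y → + w * (ℓ (φ x) * ℓ (φ y)))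
                                        (λ y → quadratic qs (φ x) (φ y))) ⟩
    _ ≡⟨ ∑-distrib-+ (λ x → sum λ y → + w * (ℓ (φ x) * ℓ (φ y)))
                     (λ x → sum λ y → quadratic qs (φ x) (φ y)) ⟩
    _ ≡⟨ cong (_+ sum λ x → sum λ y → quadratic qs (φ x) (φ y)) factor ⟩
    _ ∎

-- Fixing the three labelled vertices fixes the type; the remaining double sum is then a weighted
-- sum of squares.
∑ⱽ-form-nonneg : ∀ {n} (e : Fin n → Fin n → Bool) → 0ℤ ℤ.≤ ∑ⱽ (form e)
∑ⱽ-form-nonneg e = sum-nonneg λ a → sum-nonneg λ b → sum-nonneg λ c →
  quadratic-nonneg (squares (e a b , e a c , e b c)) λ x → e x a , e x b , e x c

pentagon-tuples-≤ : ∀ {n} (e : Fin n → Fin n → Bool) →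
  (∀ x y → e x y ≡ e y x) → NoTriangle e →
  + 10000 * ∑ⱽ (𝟙 ∘ isPentagon e) ℤ.≤ (+ n) ℤ.^ 5 * + 32
pentagon-tuples-≤ {n} e e-sym e-tf = begin
  + 10000 * ∑ⱽ (𝟙 ∘ isPentagon e)
    ≡⟨ ∑ⱽ-*ˡ (+ 10000) (𝟙 ∘ isPentagon e) ⟨
  ∑ⱽ (λ v → + 10000 * 𝟙 (isPentagon e v))
    ≡⟨ ℤ.+-identityʳ _ ⟨
  ∑ⱽ (λ v → + 10000 * 𝟙 (isPentagon e v)) + 0ℤ
    ≤⟨ ℤ.+-monoʳ-≤ (∑ⱽ λ v → + 10000 * 𝟙 (isPentagon e v)) (∑ⱽ-form-nonneg e) ⟩
  ∑ⱽ (λ v → + 10000 * 𝟙 (isPentagon e v)) + ∑ⱽ (form e)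
    ≡⟨ ∑ⱽ-+ (λ v → + 10000 * 𝟙 (isPentagon e v)) (form e) ⟨
  ∑ⱽ (certificate e)
    -- The certificate itself need not be small at every tuple; multiplying by 120 allows replacing
    -- it by its symmetrisation, which is bounded pointwise.
    ≤⟨ ℤ.*-cancelˡ-≤-pos _ _ (+ 120) symmetrised ⟩
  (+ n) ℤ.^ 5 * + 32 ∎
  where
  open ℤ.≤-Reasoning

  -- A loop at `x` would be the degenerate triangle `x x x`.
  e-irr : ∀ x → e x x ≡ false
  e-irr x with e x x in eq
  ... | false = refl
  ... | true  = contradiction (subst (λ b → T (b ∧ b ∧ b)) (sym eq) tt) (e-tf x x x)

  -- The tuple `v` is the image of its positions under `lookup v`, and this commutes with permuting,
  -- so the sum at `v` is one of the values already checked.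
  pointwise : ∀ v → symm S₅ (certificate e) v ℤ.≤ + 3840
  pointwise v = subst (ℤ._≤ + 3840)
    (∑ₗ-cong S₅ λ w → sym (reindex w))
    (certificate-pattern (pattern-of e v) λ x y z t →
      e-tf (lookup v x) (lookup v y) (lookup v z)
        (subst T (sym (cong₂ _∧_ (eq x y) (cong₂ _∧_ (eq y z) (eq z x)))) t))
    where
    eq = adj-pattern-of e-sym e-irr v
    reindex : ∀ w → certificate e (act w v)
                  ≡ certificate (adj (pattern-of e v)) (act w (allFin 5))
    reindex w = trans
      (cong (certificate e) (trans
        (cong (act w) (sym (Vec.map-lookup-allFin v)))
        (act-map (lookup v) w (allFin 5))))
      (certificate-map eq (act w (allFin 5)))

  symmetrised : + 120 * ∑ⱽ (certificate e) ℤ.≤ + 120 * ((+ n) ℤ.^ 5 * + 32)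
  symmetrised = begin
    + 120 * ∑ⱽ (certificate e)    ≡⟨ ∑ⱽ-symm S₅ (certificate e) ⟨
    ∑ⱽ (symm S₅ (certificate e))  ≤⟨ ∑ⱽ-mono-≤ pointwise ⟩
    ∑ⱽ {n} {5} (λ _ → + 3840)     ≡⟨ ∑ⱽ-const {n} 5 (+ 3840) ⟩
    (+ n) ℤ.^ 5 * (+ 32 * + 120)  ≡⟨ ℤ.*-assoc ((+ n) ℤ.^ 5) (+ 32) (+ 120) ⟨
    (+ n) ℤ.^ 5 * + 32 * + 120    ≡⟨ ℤ.*-comm ((+ n) ℤ.^ 5 * + 32) (+ 120) ⟩
    + 120 * ((+ n) ℤ.^ 5 * + 32)  ∎

-- Counting distinct tuples by a sum of indicators.

infix 4 _≟ᵛ_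
_≟ᵛ_ : ∀ {n k} (v w : Vec (Fin n) k) → Dec (v ≡ w)
_≟ᵛ_ = Vec.≡-dec Fin._≟_

-- Induction on the list with a changing predicate: `p` splits into the indicator `δ` of the head
-- and the rest `p′`, which the tail still satisfies because the head does not recur.
length≤∑ⱽ : ∀ {n k} (p : Vec (Fin n) k → Bool) {vs : List (Vec (Fin n) k)} →
  Uniqueₚ vs → All (T ∘ p) vs → + length vs ℤ.≤ ∑ⱽ (𝟙 ∘ p)
length≤∑ⱽ p [] [] = ∑ⱽ-nonneg λ v → 𝟙-nonneg (p v)
length≤∑ⱽ p {w ∷ vs} (w∉vs ∷ vs!) (pw ∷ pvs) = begin
  1ℤ + + length vs           ≤⟨ ℤ.+-mono-≤ one (length≤∑ⱽ p′ vs! p′vs) ⟩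
  ∑ⱽ (𝟙 ∘ δ) + ∑ⱽ (𝟙 ∘ p′)   ≡⟨ ∑ⱽ-+ (𝟙 ∘ δ) (𝟙 ∘ p′) ⟨
  ∑ⱽ (λ v → 𝟙 (δ v) + 𝟙 (p′ v)) ≤⟨ ∑ⱽ-mono-≤ split ⟩
  ∑ⱽ (𝟙 ∘ p)                 ∎
  where
  open ℤ.≤-Reasoning

  δ p′ : Vec (Fin _) _ → Bool
  δ v  = does (w ≟ᵛ v)
  p′ v = not (δ v) ∧ p v

  one : 1ℤ ℤ.≤ ∑ⱽ (𝟙 ∘ δ)
  one = subst (λ b → 𝟙 b ℤ.≤ ∑ⱽ (𝟙 ∘ δ)) (dec-true (w ≟ᵛ w) refl)
    (term≤∑ⱽ (λ v → 𝟙-nonneg (δ v)) w)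

  p′vs : All (T ∘ p′) vs
  p′vs = All.zipWith (λ {v} (w≢v , pv) →
    subst (λ b → T (not b ∧ p v)) (sym (dec-false (w ≟ᵛ v) w≢v)) pv) (w∉vs , pvs)

  split : ∀ v → 𝟙 (δ v) + 𝟙 (p′ v) ℤ.≤ 𝟙 (p v)
  split v with w ≟ᵛ v
  ... | no  _    = ℤ.≤-reflexive (ℤ.+-identityˡ (𝟙 (p v)))
  ... | yes refl = ℤ.≤-reflexive (cong 𝟙 (sym (to T-≡ pw)))

-- Boolean adjacency of a graph and the automorphisms of `C₅`.

adjacent : {V : Set} → Graph V → V → V → Bool
adjacent G x y = ⌊ x ~? y ⌋
  where open Graph G

adjacent-sym : ∀ {V : Set} (G : Graph V) x y → adjacent G x y ≡ adjacent G y x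
adjacent-sym G x y with x ~? y | y ~? x
  where open Graph G
... | yes _   | yes _   = refl
... | no  _   | no  _   = refl
... | yes x~y | no  y≁x = contradiction (Graph.~-sym G x~y) y≁x
... | no  x≁y | yes y~x = contradiction (Graph.~-sym G y~x) x≁y

adjacent-noTriangle : ∀ {V : Set} (G : Graph V) → TriangleFree G → NoTriangle (adjacent G)
adjacent-noTriangle G G-tf x y z t =
  let xy , yz∧zx = to (T-∧ {adjacent G x y}) t
      yz , zx    = to (T-∧ {adjacent G y z}) yz∧zx
  in G-tf x y z (toWitness xy , toWitness yz , toWitness zx)

-- The dihedral group of order ten, found by keeping those permutations that send the cycle to a
-- closed walk.
automorphisms : List (Vec (Fin 5) 5)
automorphisms = filter (λ σ → T? (isPentagon (adjacent C₅) σ)) (map (λ w → act w (allFin 5)) S₅)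

IsAutomorphism : Vec (Fin 5) 5 → Set
IsAutomorphism σ =
    (∀ k → ∃ λ i → lookup σ i ≡ k)
  × (∀ i j → (lookup σ i ~ lookup σ j → i ~ j) × (i ~ j → lookup σ i ~ lookup σ j))
  where open Graph C₅

automorphisms-valid : All IsAutomorphism automorphisms
automorphisms-valid = from-yes (All.all? (λ σ →
  (Fin.all? λ k → Fin.any? λ i → lookup σ i Fin.≟ k) ×-dec
  (Fin.all? λ i → Fin.all? λ j →
    ((lookup σ i ~? lookup σ j) →-dec (i ~? j)) ×-dec
    ((i ~? j) →-dec (lookup σ i ~? lookup σ j)))) automorphisms)
  where open Graph C₅

automorphisms-pentagon : All (T ∘ isPentagon (adjacent C₅)) automorphisms
automorphisms-pentagon = All.all-filter (λ σ → T? (isPentagon (adjacent C₅) σ))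
  (map (λ w → act w (allFin 5)) S₅)

automorphisms-unique : Uniqueₚ automorphisms
automorphisms-unique = from-yes (DecUnique.unique? _≟ᵛ_ automorphisms)

isPentagon-map : ∀ {U V : Set} {e : V → V → Bool} {e′ : U → U → Bool} {g : U → V} →
  (∀ x y → T (e′ x y) → T (e (g x) (g y))) →
  ∀ v → T (isPentagon e′ v) → T (isPentagon e (Vec.map g v))
isPentagon-map hom (a ∷ b ∷ c ∷ x ∷ y ∷ []) =
  hom a b ∧⁺ hom b c ∧⁺ hom x c ∧⁺ hom y x ∧⁺ hom y a
  where
  infixr 4 _∧⁺_
  _∧⁺_ : ∀ {p p′ q q′ : Bool} → (T p → T p′) → (T q → T q′) → T (p ∧ q) → T (p′ ∧ q′)
  _∧⁺_ {p} {p′} f g t = from (T-∧ {p′}) (f (proj₁ (to (T-∧ {p}) t)) , g (proj₂ (to (T-∧ {p}) t)))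

vec-map-injective : ∀ {A B : Set} {n} {f : A → B} → (∀ {x y} → f x ≡ f y → x ≡ y) →
  {v w : Vec A n} → Vec.map f v ≡ Vec.map f w → v ≡ w
vec-map-injective inj {[]}    {[]}    eq = refl
vec-map-injective inj {x ∷ v} {y ∷ w} eq =
  cong₂ _∷_ (inj (Vec.∷-injectiveˡ eq)) (vec-map-injective inj (Vec.∷-injectiveʳ eq))

-- The ten labellings of each five-cycle.

module _ {n : ℕ} {G : Graph (Fin n)} where

  open Graph G
  open Subgraph
  private module C₅ = Graph C₅

  -- Refers to the tuple but to no chosen isomorphism, so that one tuple can be compared with two
  -- subgraphs.
  record Labels (H : Subgraph G) (v : Vec (Fin n) 5) : Set where
    field
      covers : ∀ {u} → u ∈ vertices H → ∃ λ i → lookup v i ≡ u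
      inside : ∀ i → lookup v i ∈ vertices H
      edges  : ∀ i j → Edge H (lookup v i) (lookup v j) ⇔ (i C₅.~ j)

  open Labels

  labels-edge : ∀ {H K v} → Labels H v → Labels K v →
    ∀ {u w} → Edge H u w → Edge K u w
  labels-edge {H} ℓ ℓ′ uw with edge⇒∈ H uw
  ... | u∈H , w∈H with covers ℓ u∈H | covers ℓ w∈H
  ... | i , refl | j , refl = from (edges ℓ′ i j) (to (edges ℓ i j) uw)

  labels-vertex : ∀ {H K v} → Labels H v → Labels K v →
    ∀ {u} → u ∈ vertices H → u ∈ vertices K
  labels-vertex ℓ ℓ′ u∈H with covers ℓ u∈H
  ... | i , refl = inside ℓ′ i

  -- The vertices are the entries of `v` and the edges are those of `C₅` transported along `v`, so
  -- the tuple fixes both.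
  labels-determine : ∀ {H K v} → Labels H v → Labels K v →
    vertices H ≡ vertices K × (∀ u w → Edge H u w ⇔ Edge K u w)
  labels-determine ℓ ℓ′ =
      ⊆-antisym (labels-vertex ℓ ℓ′) (labels-vertex ℓ′ ℓ)
    , λ u w → mk⇔ (labels-edge ℓ ℓ′) (labels-edge ℓ′ ℓ)

  module _ (H : Subgraph G) (iso : IsFiveCycle H) where

    module I = _≅_ iso

    vertex : Fin 5 → Fin n
    vertex i = proj₁ (I.from i)

    vertex-to : ∀ {u} (u∈H : u ∈ vertices H) → vertex (I.to (u , u∈H)) ≡ u
    vertex-to u∈H = cong proj₁ (Inverse.strictlyInverseʳ I.bijection (-, u∈H))

    vertex-edge : ∀ i j → Edge H (vertex i) (vertex j) ⇔ (i C₅.~ j)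
    vertex-edge i j = subst₂ (λ a b → Edge H (vertex i) (vertex j) ⇔ (a C₅.~ b))
      (Inverse.strictlyInverseˡ I.bijection i) (Inverse.strictlyInverseˡ I.bijection j)
      (I.preserves (I.from i) (I.from j))

    vertex-injective : ∀ {i j} → vertex i ≡ vertex j → i ≡ j
    vertex-injective {i} {j} eq = begin
      i                ≡⟨ Inverse.strictlyInverseˡ I.bijection i ⟨
      I.to (I.from i)  ≡⟨ to-cong eq (proj₂ (I.from i)) (proj₂ (I.from j)) ⟩
      I.to (I.from j)  ≡⟨ Inverse.strictlyInverseˡ I.bijection j ⟩
      j                ∎
      where
      open ≡-Reasoning
      to-cong : ∀ {u w} → u ≡ w → (u∈H : u ∈ vertices H) (w∈H : w ∈ vertices H) →
        I.to (u , u∈H) ≡ I.to (w , w∈H)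
      -- Membership proofs are unique, so equal vertices of `G` are equal as vertices of the
      -- subgraph.
      to-cong refl u∈H w∈H = cong (λ p → I.to (-, p)) ([]=-irrelevant u∈H w∈H)

    labellings : List (Vec (Fin n) 5)
    labellings = map (Vec.map vertex) automorphisms

    labellings-unique : Uniqueₚ labellings
    labellings-unique = map⁺ (vec-map-injective vertex-injective) automorphisms-unique

    labellings-pentagon : All (T ∘ isPentagon (adjacent G)) labellings
    labellings-pentagon = All.map⁺ {f = Vec.map vertex}
      (All.map (λ {σ} → isPentagon-map {e = adjacent G} {g = vertex} hom σ) automorphisms-pentagon)
      where
      hom : ∀ i j → T (adjacent C₅ i j) → T (adjacent G (vertex i) (vertex j))
      hom i j t = fromWitness (edge⇒~ H (from (vertex-edge i j) (toWitness t)))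

    labellings-label : ∀ {v} → v ∈ₗ labellings → Labels H v
    labellings-label v∈ with ∈-map⁻ (Vec.map vertex) v∈
    ... | σ , σ∈ , refl = record
      { covers = λ u∈H → let i , σi≡k = surj (I.to (-, u∈H)) in
          i , trans (Vec.lookup-map i vertex σ) (trans (cong vertex σi≡k) (vertex-to u∈H))
      ; inside = λ i → subst (_∈ vertices H) (sym (Vec.lookup-map i vertex σ))
          (proj₂ (I.from (lookup σ i)))
      ; edges = λ i j → subst₂ (λ u w → Edge H u w ⇔ (i C₅.~ j))
          (sym (Vec.lookup-map i vertex σ)) (sym (Vec.lookup-map j vertex σ))
          (mk⇔ (proj₁ (auto i j) ∘ to (vertex-edge _ _)) (from (vertex-edge _ _) ∘ proj₂ (auto i j)))
      }
      where
      surj = proj₁ (All.lookup automorphisms-valid σ∈)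
      auto = proj₂ (All.lookup automorphisms-valid σ∈)

  tuples : (Hs : List (Subgraph G)) → All IsFiveCycle Hs → List (Vec (Fin n) 5)
  tuples []       []           = []
  tuples (H ∷ Hs) (iso ∷ isos) = labellings H iso ++ tuples Hs isos

  length-tuples : ∀ Hs isos → length (tuples Hs isos) ≡ length Hs ℕ.* 10
  length-tuples []       []           = refl
  length-tuples (H ∷ Hs) (iso ∷ isos) = trans
    (length-++ (labellings H iso) {tuples Hs isos})
    -- The 10 comes from evaluating the closed list `automorphisms`.
    (cong (10 ℕ.+_) (length-tuples Hs isos))

  tuples-pentagon : ∀ Hs isos → All (T ∘ isPentagon (adjacent G)) (tuples Hs isos)
  tuples-pentagon []       []           = []
  tuples-pentagon (H ∷ Hs) (iso ∷ isos) =
    All.++⁺ (labellings-pentagon H iso) (tuples-pentagon Hs isos)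

  tuples-label : ∀ Hs isos {v} → v ∈ₗ tuples Hs isos → Any (λ H → Labels H v) Hs
  tuples-label (H ∷ Hs) (iso ∷ isos) v∈ with ∈-++⁻ (labellings H iso) v∈
  ... | inj₁ v∈ˡ = here (labellings-label H iso v∈ˡ)
  ... | inj₂ v∈ʳ = there (tuples-label Hs isos v∈ʳ)

  -- A tuple occurring for two cycles would label both and force them to be the same subgraph.
  tuples-unique : ∀ Hs → Unique (subgraphs G) Hs → ∀ isos → Uniqueₚ (tuples Hs isos)
  tuples-unique []       []         []           = []
  tuples-unique (H ∷ Hs) (H∉ ∷ Hs!) (iso ∷ isos) =
    ++⁺ (labellings-unique H iso) (tuples-unique Hs Hs! isos) λ (v∈ˡ , v∈ʳ) →
      All.All¬⇒¬Any
        (All.map (λ H≉K ℓ → H≉K (labels-determine (labellings-label H iso v∈ˡ) ℓ)) H∉)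
        (tuples-label Hs isos v∈ʳ)

-- The final bound, first in integers and then in rationals.

toℚᵘ-homo-^ : ∀ p k → toℚᵘ (p ^ k) ℚᵘ.≃ toℚᵘ p ^ᵘ k
toℚᵘ-homo-^ p zero    = ℚᵘ.≃-refl
toℚᵘ-homo-^ p (suc k) = ℚᵘ.≃-trans
  (ℚ.toℚᵘ-homo-* p (p ^ k)) (ℚᵘ.*-congˡ {toℚᵘ p} (toℚᵘ-homo-^ p k))

^ᵘ-cong : ∀ {p q} k → p ℚᵘ.≃ q → p ^ᵘ k ℚᵘ.≃ q ^ᵘ k
^ᵘ-cong zero    p≃q = ℚᵘ.≃-refl
^ᵘ-cong (suc k) p≃q = ℚᵘ.*-cong p≃q (^ᵘ-cong k p≃q)

-- Ten distinct tuples per cycle turn the tuple bound into one with factor 10 · 10000 = 3125 · 32 on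
-- the left, and the 32 cancels.
pentagons-≤ : ∀ {n} (G : Graph (Fin n)) → TriangleFree G →
  (Hs : List (Subgraph G)) → Unique (subgraphs G) Hs → All IsFiveCycle Hs →
  + length Hs * + 3125 ℤ.≤ (+ n) ℤ.^ 5
pentagons-≤ {n} G G-tf Hs Hs! isos = ℤ.*-cancelʳ-≤-pos _ _ (+ 32) (begin
  + length Hs * + 3125 * + 32          ≡⟨ ℤ.*-assoc (+ length Hs) (+ 3125) (+ 32) ⟩
  + length Hs * (+ 10 * + 10000)       ≡⟨ ℤ.*-assoc (+ length Hs) (+ 10) (+ 10000) ⟨
  + length Hs * + 10 * + 10000         ≡⟨ ℤ.*-comm (+ length Hs * + 10) (+ 10000) ⟩
  + 10000 * (+ length Hs * + 10)       ≡⟨ cong (+ 10000 *_) (ℤ.pos-* (length Hs) 10) ⟨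
  + 10000 * + (length Hs ℕ.* 10)       ≡⟨ cong (λ k → + 10000 * + k) (length-tuples Hs isos) ⟨
  + 10000 * + length (tuples Hs isos)
    ≤⟨ ℤ.*-monoˡ-≤-nonNeg (+ 10000) (length≤∑ⱽ (isPentagon (adjacent G))
         (tuples-unique Hs Hs! isos) (tuples-pentagon Hs isos)) ⟩
  + 10000 * ∑ⱽ (𝟙 ∘ isPentagon (adjacent G))
    ≤⟨ pentagon-tuples-≤ (adjacent G) (adjacent-sym G) (adjacent-noTriangle G G-tf) ⟩
  (+ n) ℤ.^ 5 * + 32                   ∎)
  where open ℤ.≤-Reasoning

theorem2 : (n : ℕ) → .{{_ : NonZero n}} → (G : Graph (Fin n)) → TriangleFree G →
    (Hs : List (Subgraph G)) → Unique (subgraphs G) Hs → All IsFiveCycle Hs →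
    (+ length Hs) / 1 ≤ ((+ n) / 5) ^ 5
theorem2 n G G-tf Hs Hs! isos = ℚ.toℚᵘ-cancel-≤ (begin
  toℚᵘ ((+ length Hs) / 1)      ≃⟨ ℚ.toℚᵘ-fromℚᵘ (ℚᵘ.mkℚᵘ (+ length Hs) 0) ⟩
  -- Unnormalised fractions keep the denominators 1 and 5⁵ = 3125, so cross-multiplying gives
  -- exactly the integer bound.
  ℚᵘ.mkℚᵘ (+ length Hs) 0       ≤⟨ ℚᵘ.*≤* (subst (+ length Hs * + 3125 ℤ.≤_)
                                     (sym (ℤ.*-identityʳ ((+ n) ℤ.^ 5)))
                                     (pentagons-≤ G G-tf Hs Hs! isos)) ⟩
  ℚᵘ.mkℚᵘ (+ n) 4 ^ᵘ 5          ≃⟨ ^ᵘ-cong 5 (ℚ.toℚᵘ-fromℚᵘ (ℚᵘ.mkℚᵘ (+ n) 4)) ⟨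
  toℚᵘ ((+ n) / 5) ^ᵘ 5         ≃⟨ toℚᵘ-homo-^ ((+ n) / 5) 5 ⟨
  toℚᵘ (((+ n) / 5) ^ 5)        ∎)
  where open ℚᵘ.≤-Reasoning
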